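{- For all integers $p \geq q \geq 1$, $$\tfrac{1}{2}pq - 1 \leq \mathrm{tw}(L(K_{p,q})) \leq \mathrm{pw}(L(K_{p,q})).$$
   Context: $K_{p,q}$ is the complete bipartite graph with parts of sizes $p$ and $q$. The line graph $L(G)$ of a graph $G$ has vertex set $E(G)$, two distinct elements being adjacent if and only if the corresponding edges of $G$ share an endpoint. A tree decomposition of a graph $H$ is a (nonempty) tree $T$ together with a collection of subsets of $V(H)$ (bags) indexed by the nodes of $T$ such that: every vertex of $H$ is in at least one bag; for each vertex $v$ of $H$, the nodes whose bags contain $v$ induce a connected subtree of $T$; and for each edge of $H$ some bag contains both its endpoints. Its width is the size of the largest bag minus 1. The treewidth $\mathrm{tw}(H)$ is the minimum width of a tree decomposition of $H$; the pathwidth $\mathrm{pw}(H)$ is the minimum width over tree decompositions whose tree $T$ is a path. -}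

module Defs where

open import Level using (0ℓ; Level)
open import Data.Empty using (⊥)
open import Data.Fin.Base using (Fin; zero; suc; toℕ; inject₁; fromℕ; splitAt; _<_)
open import Data.Fin.Properties using (_≟_; _<?_)
open import Data.Fin.Permutation using (Permutation′; _⟨$⟩ʳ_; id)
open import Data.Fin.Subset using (Subset; ∣_∣; _∈_) renaming (⊤ to full)
open import Data.Fin.Subset.Properties using (∈⊤)
open import Data.Integer.Base using (ℤ; +_; -[1+_]; _-_; +≤+) renaming (_≤_ to _≤ℤ_)
import Data.Integer.Properties as ℤ
open import Data.List.Base using (List; filter; cartesianProduct; allFin; length; lookup; tabulate)
open import Data.List.Extrema.Nat using (max)
open import Data.List.Relation.Unary.Unique.Propositional using (Unique)
import Data.List.Relation.Unary.Unique.Propositional.Properties as Unique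
open import Data.Nat.Base as ℕ using (ℕ; NonZero; _+_)
open import Data.Nat.Induction using (<-rec)
import Data.Nat.Properties as ℕ
open import Data.Product.Base using (Σ; ∃; _×_; _,_; proj₁; proj₂)
open import Data.Sum.Base using (_⊎_; inj₁; inj₂)
open import Data.Unit.Base using (⊤; tt)
open import Function.Base using (_∘_)
open import Function.Bundles using (_⇔_; mk⇔)
open import Function.Definitions using (Injective)
open import Relation.Binary.Construct.Closure.ReflexiveTransitive using (Star; ε)
open import Relation.Binary.Core using (Rel)
open import Relation.Binary.Definitions using (Symmetric; Irreflexive; Decidable)
open import Relation.Binary.PropositionalEquality using (_≡_; _≢_; refl; sym; ≢-sym)
open import Relation.Nullary using (¬_; yes; no; ¬?; _×-dec_; _⊎-dec_)

private
  variable
    m n : ℕ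

-- Finite simple graphs with vertex set Fin n.

record Graph (n : ℕ) : Set₁ where
  field
    Adj    : Rel (Fin n) 0ℓ
    adj?   : Decidable Adj
    symm   : Symmetric Adj
    irrefl : Irreflexive _≡_ Adj

open Graph public

-- K p q: the first p elements of Fin (p + q) form one part, the last q the other.

OppositeParts : {p q : ℕ} → Rel (Fin p ⊎ Fin q) 0ℓ
OppositeParts (inj₁ _) (inj₁ _) = ⊥
OppositeParts (inj₁ _) (inj₂ _) = ⊤
OppositeParts (inj₂ _) (inj₁ _) = ⊤
OppositeParts (inj₂ _) (inj₂ _) = ⊥

private
  opposite? : {p q : ℕ} → Decidable (OppositeParts {p} {q})
  opposite? (inj₁ _) (inj₁ _) = no λ ()
  opposite? (inj₁ _) (inj₂ _) = yes tt
  opposite? (inj₂ _) (inj₁ _) = yes tt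
  opposite? (inj₂ _) (inj₂ _) = no λ ()

  opposite-sym : {p q : ℕ} → Symmetric (OppositeParts {p} {q})
  opposite-sym {x = inj₁ _} {inj₂ _} _ = tt
  opposite-sym {x = inj₂ _} {inj₁ _} _ = tt

  opposite-irrefl : {p q : ℕ} → Irreflexive _≡_ (OppositeParts {p} {q})
  opposite-irrefl {x = inj₁ _} refl ()
  opposite-irrefl {x = inj₂ _} refl ()

K : (p q : ℕ) → Graph (p + q)
K p q .Adj u v       = OppositeParts (splitAt p u) (splitAt p v)
K p q .adj? u v      = opposite? (splitAt p u) (splitAt p v)
K p q .symm {u} {v}  = opposite-sym {x = splitAt p u} {splitAt p v}
K p q .irrefl {u} refl = opposite-irrefl {x = splitAt p u} refl

-- An (unordered) edge {u , v} is listed exactly once, as the pair with u < v.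

edges : Graph n → List (Fin n × Fin n)
edges {n} G =
  filter (λ (u , v) → (u <? v) ×-dec adj? G u v) (cartesianProduct (allFin n) (allFin n))

edges-unique : (G : Graph n) → Unique (edges G)
edges-unique {n} G =
  Unique.filter⁺ (λ (u , v) → (u <? v) ×-dec adj? G u v)
    (Unique.cartesianProduct⁺ (Unique.allFin⁺ n) (Unique.allFin⁺ n))

_IsEndOf_ : Fin n → Fin n × Fin n → Set
w IsEndOf (u , v) = w ≡ u ⊎ w ≡ v

ShareEndpoint : Rel (Fin n × Fin n) 0ℓ
ShareEndpoint e f = ∃ λ w → w IsEndOf e × w IsEndOf f

private
  share? : Decidable (ShareEndpoint {n})
  share? (a , b) (c , d) with (a ≟ c) ⊎-dec (a ≟ d) | (b ≟ c) ⊎-dec (b ≟ d)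
  ... | yes h | _     = yes (a , inj₁ refl , h)
  ... | no _  | yes h = yes (b , inj₂ refl , h)
  ... | no ¬a | no ¬b = no λ { (_ , inj₁ refl , h) → ¬a h ; (_ , inj₂ refl , h) → ¬b h }

-- The vertices of the line graph are the positions in the list of edges; as the list
-- has no repetition, distinct positions are distinct edges.

L : (G : Graph n) → Graph (length (edges G))
L G .Adj i j  = i ≢ j × ShareEndpoint (lookup (edges G) i) (lookup (edges G) j)
L G .adj? i j = ¬? (i ≟ j) ×-dec share? (lookup (edges G) i) (lookup (edges G) j)
L G .symm (i≢j , w , w∈e , w∈f) = ≢-sym i≢j , w , w∈f , w∈e
L G .irrefl i≡j (i≢j , _) = i≢j i≡j

Connected : Graph n → Set
Connected G = ∀ u v → Star (Adj G) u v

InducesConnected : Graph n → (Fin n → Set) → Set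
InducesConnected G P =
  ∀ {u v} → P u → P v → Star (λ x y → P x × P y × Adj G x y) u v

record Cycle (G : Graph n) : Set where
  field
    {k}    : ℕ
    vertex : Fin (3 + k) → Fin n
    inj    : Injective _≡_ _≡_ vertex
    step   : (i : Fin (2 + k)) → Adj G (vertex (inject₁ i)) (vertex (suc i))
    close  : Adj G (vertex (fromℕ (2 + k))) (vertex zero)

record IsTree (G : Graph n) : Set where
  field
    nonEmpty  : NonZero n
    connected : Connected G
    acyclic   : ¬ Cycle G

-- π lists the vertices in the order in which they appear along the path.

IsPath : Graph n → Set
IsPath {n} G = ∃ λ (π : Permutation′ n) → ∀ i j →
  Adj G (π ⟨$⟩ʳ i) (π ⟨$⟩ʳ j) ⇔ (toℕ j ≡ ℕ.suc (toℕ i) ⊎ toℕ i ≡ ℕ.suc (toℕ j))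

record TreeDecomposition (H : Graph n) : Set₁ where
  field
    {size}    : ℕ
    tree      : Graph size
    isTree    : IsTree tree
    bag       : Fin size → Subset n
    covers    : ∀ v → ∃ λ t → v ∈ bag t
    subtree   : ∀ v → InducesConnected tree (λ t → v ∈ bag t)
    coverEdge : ∀ {u v} → Adj H u v → ∃ λ t → u ∈ bag t × v ∈ bag t

  maxBag : ℕ
  maxBag = max 0 (tabulate (λ t → ∣ bag t ∣))

  -- An integer: the width is -1 when all bags are empty.
  width : ℤ
  width = + maxBag - + 1

open TreeDecomposition public

PathDecomposition : Graph n → Set₁
PathDecomposition H = Σ (TreeDecomposition H) (λ D → IsPath (tree D))

IsMinimum : {a : Level} {A : Set a} → (A → ℤ) → ℤ → Set a
IsMinimum f k = (∃ λ x → f x ≡ k) × (∀ x → k ≤ℤ f x)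

-- IsTreewidth H k says tw(H) = k, and IsPathwidth H k says pw(H) = k.

IsTreewidth : Graph n → ℤ → Set₁
IsTreewidth H = IsMinimum (width {H = H})

IsPathwidth : Graph n → ℤ → Set₁
IsPathwidth H = IsMinimum {A = PathDecomposition H} (width ∘ proj₁)

-- The minima are unique, and they exist (classically, hence the double negation).

minimum-unique : {a : Level} {A : Set a} {f : A → ℤ} {k l : ℤ} →
                 IsMinimum f k → IsMinimum f l → k ≡ l
minimum-unique ((x , refl) , k≤) ((y , refl) , l≤) = ℤ.≤-antisym (k≤ y) (l≤ x)

private
  minimum-exists : {a : Level} {A : Set a} (g : A → ℕ) → A →
                   ¬ ¬ ∃ (IsMinimum (λ x → + g x - + 1))
  minimum-exists {A = A} g x₀ none = <-rec (λ k → ∀ x → ¬ g x ≡ k) step (g x₀) x₀ refl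
    where
    step : ∀ k → (∀ {l} → l ℕ.< k → ∀ x → ¬ g x ≡ l) → ∀ x → ¬ g x ≡ k
    step _ smaller x refl = none
      (_ , (x , refl) ,
        λ y → ℤ.+-monoˡ-≤ -[1+ 0 ] (+≤+ (ℕ.≮⇒≥ (λ gy<gx → smaller gy<gx y refl))))

  point : Graph 1
  point .Adj _ _ = ⊥
  point .adj? _ _ = no λ ()
  point .symm ()
  point .irrefl _ ()

  point-isTree : IsTree point
  point-isTree = record
    { nonEmpty  = _
    ; connected = λ { zero zero → ε }
    ; acyclic   = λ c → Cycle.close c
    }

  point-isPath : IsPath point
  point-isPath = id , λ { zero zero → mk⇔ (λ ()) (λ { (inj₁ ()) ; (inj₂ ()) }) }

  oneBag : (H : Graph n) → PathDecomposition H
  oneBag H = record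
    { tree      = point
    ; isTree    = point-isTree
    ; bag       = λ _ → full
    ; covers    = λ _ → zero , ∈⊤
    ; subtree   = λ { _ {zero} {zero} _ _ → ε }
    ; coverEdge = λ _ → zero , ∈⊤ , ∈⊤
    } , point-isPath

treewidth-exists : (H : Graph n) → ¬ ¬ ∃ (IsTreewidth H)
treewidth-exists H = minimum-exists maxBag (proj₁ (oneBag H))

pathwidth-exists : (H : Graph n) → ¬ ¬ ∃ (IsPathwidth H)
pathwidth-exists H = minimum-exists (maxBag ∘ proj₁) (oneBag H)

{-# OPTIONS --safe #-}

-- In a tree decomposition of L(K_{p,q}) the edges at each vertex v of K_{p,q} form a clique,
-- so some node base(v) has all of them in its bag (Helly). An edge ab outside the bag of a
-- node t then has base(a) and base(b) in the same component of T - t. Give each left vertex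
-- weight q and each right vertex weight p, and let t be a centroid: a component of T - t with
-- x left and y right base nodes satisfies qx + py ≤ pq. By AM-GM it accounts for
-- xy ≤ (qx + py)/4 of the edges missing at t, hence at most pq/2 edges are missing in total and
-- the bag at t has at least pq/2 elements.
-- Both the Helly node and the centroid are sinks of an orientation without 2-cycles.

module Submission where

open import Defs
open import Data.Nat.Base as ℕ using (ℕ; zero; suc; _+_; _*_; _≤_; _<_; z≤n; s≤s)
open import Data.Integer.Base as ℤ using (ℤ; +_)
open import Data.Rational.Base as ℚ using (_/_; ½; 1ℚ; toℚᵘ)
open import Data.Product.Base using (∃; ∃₂; _×_; _,_; proj₁; proj₂)
open import Data.Bool.Base using (true; false; if_then_else_)
open import Data.Fin.Base using (Fin; zero; suc; inject₁; fromℕ; _↑ˡ_; _↑ʳ_; toℕ)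
import Data.Fin.Properties as Fin
open import Data.Fin.Properties using (_≟_; any?; all?; ¬∀⟶∃¬)
open import Data.Fin.Subset using (Subset; _∈_; _⊂_; ∣_∣)
open import Data.Fin.Subset.Induction using (⊂-wellFounded; Acc; acc)
open import Data.Fin.Subset.Properties using (_∈?_)
import Data.Integer.Properties as ℤ
import Data.Integer.Tactic.RingSolver as ℤSolver
open import Data.List.Base as List using (length)
open import Data.List.Extrema.Nat using (v≤max⁺)
open import Data.List.Membership.Propositional using () renaming (_∈_ to _∈ᴸ_)
open import Data.List.Membership.Propositional.Properties
  using (∈-filter⁺; ∈-cartesianProduct⁺; ∈-allFin; ∈-tabulate⁺)
import Data.List.Relation.Unary.Any as Any
open import Data.List.Relation.Unary.Any.Properties using (lookup-index)
open import Data.Nat.Properties as ℕ hiding (_≟_)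
open import Algebra.Properties.Semiring.Sum ℕ.+-*-semiring
  using (sum; sum-syntax; ∑-comm; ∑-distrib-+; sum-cong-≗; *-distribˡ-sum; *-distribʳ-sum)
open import Data.Nat.Tactic.RingSolver using (solve-∀)
import Data.Rational.Properties as ℚ
open import Data.Rational.Unnormalised.Base as ℚᵘ using (mkℚᵘ; *≤*)
import Data.Rational.Unnormalised.Properties as ℚᵘ
open import Data.Sum.Base using (_⊎_; inj₁; inj₂)
open import Data.Unit.Base using (tt)
open import Data.Vec.Base as Vec using ([]; _∷_)
open import Data.Vec.Functional as Vector using ()
open import Data.Vec.Properties using (lookup∘tabulate; lookup⇒[]=; []=⇒lookup)
open import Function.Base using (_∘_; id)
open import Function.Definitions using (Injective)
open import Relation.Binary.Construct.Closure.ReflexiveTransitive using (Star; ε; _◅_; _◅◅_)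
open import Relation.Binary.PropositionalEquality
open import Relation.Nullary
open import Relation.Nullary.Decidable using (dec-true; decidable-stable)

private
  variable
    k m n : ℕ

-- Walks and simple paths.

Star-preserves : ∀ {a r ℓ} {A : Set a} {R : A → A → Set r} (P : A → Set ℓ) →
                 (∀ {y z} → R y z → P y → P z) → ∀ {x y} → Star R x y → P x → P y
Star-preserves P step ε        p = p
Star-preserves P step (r ◅ rs) p = Star-preserves P step rs (step r p)

-- Nodes are indexed by `Fin` as in `Cycle`, so that a simple path with one more node in front has
-- the shape that `acyclic` refutes.
record SimplePath {n} (R : Fin n → Fin n → Set) (x z : Fin n) : Set where
  constructor simplePath
  field
    {len}  : ℕ
    vertex : Fin (suc len) → Fin n
    inj    : Injective _≡_ _≡_ vertex
    step   : ∀ i → R (vertex (inject₁ i)) (vertex (suc i))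
    start  : vertex zero ≡ x
    end    : vertex (fromℕ len) ≡ z

module _ {R : Fin n → Fin n → Set} where

  suffix : ∀ {x y z} (p : SimplePath R x z) i → SimplePath.vertex p i ≡ y → SimplePath R y z
  suffix (simplePath f inj step _ end) zero eq = simplePath f inj step eq end
  suffix {y = y} {z} (simplePath {suc k} f inj step _ end) (suc i) eq =
    suffix {y = y} {z} (simplePath (f ∘ suc) (Fin.suc-injective ∘ inj) (step ∘ suc) refl end) i eq

  -- If the new first node already occurs on the simple path built for the rest, the suffix from
  -- that occurrence is taken; otherwise the node goes in front.
  loopErase : ∀ {x z} → Star R x z → SimplePath R x z
  loopErase {x} ε = simplePath {len = 0} (λ _ → x) (λ { {zero} {zero} _ → refl }) (λ ()) refl refl
  loopErase {x} (r ◅ rs) with loopErase rs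
  ... | p@(simplePath f inj step refl end) with any? (λ i → f i ≟ x)
  ... | yes (i , fi≡x) = suffix p i fi≡x
  ... | no x∉f = simplePath (x Vector.∷ f)
    (λ { {zero} {zero} _ → refl
       ; {zero} {suc j} eq → contradiction (j , sym eq) x∉f
       ; {suc i} {zero} eq → contradiction (i , eq) x∉f
       ; {suc i} {suc j} eq → cong suc (inj eq) })
    (λ { zero → r ; (suc i) → step i }) refl end

-- Components of a tree minus a node.

module _ (G : Graph n) where

  -- Only the target of a step is kept off `t`; that a walk also starts off `t` is a separate fact,
  -- usually supplied by adjacency.
  Avoiding : Fin n → Fin n → Fin n → Set
  Avoiding t y z = Adj G y z × z ≢ t

  -- For adjacent t and u, the component of u in the tree minus t.
  Side : Fin n → Fin n → Fin n → Set
  Side t u = Star (Avoiding t) u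

module Tree {T : Graph n} (isTree : IsTree T) where
  open IsTree isTree

  adj⇒≢ : ∀ {t u} → Adj T t u → t ≢ u
  adj⇒≢ t~u refl = irrefl T refl t~u

  side-avoids : ∀ {t u x} → u ≢ t → Side T t u x → x ≢ t
  side-avoids {t} u≢t p = Star-preserves (_≢ t) (λ r _ → proj₂ r) p u≢t

  side-snoc : ∀ {t u y z} → Side T t u y → Adj T y z → z ≢ t → Side T t u z
  side-snoc p y~z z≢t = p ◅◅ ((y~z , z≢t) ◅ ε)

  side-sym : ∀ {t u x} → u ≢ t → Side T t u x → Side T t x u
  side-sym u≢t ε = ε
  side-sym u≢t ((u~y , y≢t) ◅ p) = side-snoc (side-sym y≢t p) (symm T u~y) u≢t

  -- If `u` and `v` were distinct, a simple path between them off `t` would close up through `t` to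
  -- a cycle on at least three nodes.
  side-nbr-unique : ∀ {t u v} → Adj T t u → Adj T t v → Side T t u v → u ≡ v
  side-nbr-unique {t} {u} {v} t~u t~v p with loopErase p
  ... | simplePath {zero} f inj step refl refl = refl
  ... | simplePath {suc k} f inj step refl refl = contradiction cycle acyclic
    where
    f≢t : ∀ i → f i ≢ t
    f≢t zero    = ≢-sym (adj⇒≢ t~u)
    f≢t (suc i) = proj₂ (step i)
    cycle : Cycle T
    cycle = record
      { vertex = t Vector.∷ f
      ; inj    = λ { {zero} {zero} _ → refl
                   ; {zero} {suc j} eq → contradiction (sym eq) (f≢t j)
                   ; {suc i} {zero} eq → contradiction eq (f≢t i)
                   ; {suc i} {suc j} eq → cong suc (inj eq) }
      ; step   = λ { zero → t~u ; (suc i) → proj₁ (step i) }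
      ; close  = symm T t~v
      }

  side-unique : ∀ {t u v x} → Adj T t u → Adj T t v → Side T t u x → Side T t v x → u ≡ v
  side-unique t~u t~v p q =
    side-nbr-unique t~u t~v (p ◅◅ side-sym (≢-sym (adj⇒≢ t~v)) q)

  -- After its last visit to `t` a walk avoids `t`. The step that leaves `t` is kept with its
  -- relation `R`: `branch` takes all walks, while `sides-disjoint` takes walks that also avoid a
  -- second node.
  lastStep : ∀ {R : Fin n → Fin n → Set} {t} → (∀ {y z} → R y z → Adj T y z) →
             ∀ {x} → Star R t x → x ≡ t ⊎ ∃₂ λ y z → R y z × y ≡ t × Side T t z x
  lastStep {R} {t} R⊆Adj p = Star-preserves P step p (inj₁ refl)
    where
    P : Fin n → Set
    P x = x ≡ t ⊎ ∃₂ λ y z → R y z × y ≡ t × Side T t z x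
    step : ∀ {y z} → R y z → P y → P z
    step {y} {z} r _ with z ≟ t
    step r _                            | yes z≡t = inj₁ z≡t
    step r (inj₁ y≡t)                   | no _    = inj₂ (_ , _ , r , y≡t , ε)
    step r (inj₂ (_ , _ , r′ , eq , p)) | no z≢t  =
      inj₂ (_ , _ , r′ , eq , side-snoc p (R⊆Adj r) z≢t)

  branch : ∀ t {x} → x ≢ t → ∃ λ u → Adj T t u × Side T t u x
  branch t {x} x≢t with lastStep id (connected t x)
  ... | inj₁ x≡t                         = contradiction x≡t x≢t
  ... | inj₂ (_ , u , t~u , refl , p) = u , t~u , p

  -- A walk from `t` to `x` off `u` finally leaves `t` through a neighbour `w` other than `u`. Then
  -- `x` would lie on the sides of both `w` and `u` at `t`.
  sides-disjoint : ∀ {t u x} → Adj T t u → Side T t u x → ¬ Side T u t x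
  sides-disjoint t~u p q with lastStep proj₁ q
  ... | inj₁ x≡t = side-avoids (≢-sym (adj⇒≢ t~u)) p x≡t
  ... | inj₂ (_ , w , (t~w , w≢u) , refl , q′) = w≢u (side-unique t~w t~u q′ p)

  -- Each node other than `t` is on the side of exactly one neighbour of `t`, so it suffices to
  -- compare that neighbour with `u`.
  side? : ∀ {t u} → Adj T t u → ∀ x → Dec (Side T t u x)
  side? {t} {u} t~u x with x ≟ t
  ... | yes refl = no λ p → side-avoids (≢-sym (adj⇒≢ t~u)) p refl
  ... | no x≢t with branch t x≢t
  ... | v , t~v , p with v ≟ u
  ... | yes refl = yes p
  ... | no v≢u = no λ q → v≢u (side-unique t~v t~u p q)

  -- A walk from `v` off `u` cannot reach `t`: the only neighbour of `t` on this side is `u` itself.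
  side-shrinks : ∀ {t u v x} → Adj T t u → Adj T u v → v ≢ t → Side T u v x → Side T t u x
  side-shrinks {t} {u} t~u u~v v≢t p =
    proj₁ (Star-preserves (λ y → Side T t u y × y ≢ u) step p
      (side-snoc ε u~v v≢t , ≢-sym (adj⇒≢ u~v)))
    where
    step : ∀ {y z} → Avoiding T u y z → Side T t u y × y ≢ u → Side T t u z × z ≢ u
    step (y~z , z≢u) (q , y≢u) =
      side-snoc q y~z
        (λ { refl → y≢u (sym (side-nbr-unique t~u (symm T y~z) q)) }) , z≢u

  sideSet : ∀ {t u} → Adj T t u → Subset n
  sideSet t~u = Vec.tabulate (λ x → does (side? t~u x))

  ∈-sideSet⁺ : ∀ {t u x} (t~u : Adj T t u) → Side T t u x → x ∈ sideSet t~u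
  ∈-sideSet⁺ {x = x} t~u p = lookup⇒[]= x (sideSet t~u)
    (trans (lookup∘tabulate _ x) (dec-true (side? t~u x) p))

  ∈-sideSet⁻ : ∀ {t u x} (t~u : Adj T t u) → x ∈ sideSet t~u → Side T t u x
  ∈-sideSet⁻ {x = x} t~u x∈ with side? t~u x
                             | trans (sym (lookup∘tabulate (λ y → does (side? t~u y)) x)) ([]=⇒lookup x∈)
  ... | yes p | _  = p
  ... | no _  | ()

  sideSet-⊂ : ∀ {t u v} (t~u : Adj T t u) (u~v : Adj T u v) → v ≢ t →
              sideSet u~v ⊂ sideSet t~u
  sideSet-⊂ {u = u} t~u u~v v≢t =
    (λ x∈ → ∈-sideSet⁺ t~u (side-shrinks t~u u~v v≢t (∈-sideSet⁻ u~v x∈))) ,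
    -- Strictness: `u` is on its own side of `t` but not in a component of the tree minus `u`.
    u , ∈-sideSet⁺ t~u ε ,
    λ u∈ → side-avoids (≢-sym (adj⇒≢ u~v)) (∈-sideSet⁻ u~v u∈) refl

  -- Following the arrows never turns back, so the side ahead of the walk shrinks strictly.
  sink : ∀ {Arrow : Fin n → Fin n → Set} {Sink : Fin n → Set} →
         (∀ {t u} → Arrow t u → ¬ Arrow u t) →
         (∀ t → Sink t ⊎ ∃ λ u → Adj T t u × Arrow t u) →
         Fin n → ∃ Sink
  sink {Arrow} {Sink} asym next t₀ with next t₀
  ... | inj₁ s = t₀ , s
  ... | inj₂ (u₀ , t~u₀ , a₀) = follow t~u₀ a₀ (⊂-wellFounded _)
    where
    follow : ∀ {t u} (t~u : Adj T t u) → Arrow t u → Acc _⊂_ (sideSet t~u) → ∃ Sink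
    follow {u = u} t~u a (acc rec) with next u
    ... | inj₁ s = u , s
    ... | inj₂ (v , u~v , b) = follow u~v b (rec (sideSet-⊂ t~u u~v λ { refl → asym a b }))

-- Bags and the Helly property.

module Decomposition {H : Graph n} (D : TreeDecomposition H) where
  open Tree (isTree D) public

  someNode : Fin (size D)
  someNode with size D | IsTree.nonEmpty (isTree D)
  ... | suc _ | _ = zero

  -- The nodes whose bags contain `v` are connected and miss `t`, so they all lie in one component
  -- of the tree minus `t`.
  bag-side : ∀ {t u v x y} → ¬ v ∈ bag D t → v ∈ bag D x → v ∈ bag D y →
             Side (tree D) t u x → Side (tree D) t u y
  bag-side {t} {u} {v} v∉t v∈x v∈y =
    Star-preserves (Side (tree D) t u)
      (λ (_ , v∈z , y~z) p → side-snoc p y~z λ { refl → v∉t v∈z })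
      (subtree D v v∈x v∈y)

  -- An arrow leads from `t` towards all the bags of some clique element missing at `t`. Opposite
  -- arrows along an edge would separate the bags of two clique elements, yet these share a bag.
  cliqueBag : (c : Fin m → Fin n) → (∀ {i j} → i ≢ j → Adj H (c i) (c j)) →
              ∃ λ t → ∀ i → c i ∈ bag D t
  cliqueBag {m} c clique = sink {Arrow} asym next someNode
    where
    Arrow : Fin (size D) → Fin (size D) → Set
    Arrow t u = Adj (tree D) t u × ∃ λ i → ∀ {x} → c i ∈ bag D x → Side (tree D) t u x

    -- The case `i ≡ j` occurs too, since opposite arrows might come from the same clique element.
    commonNode : ∀ i j → ∃ λ x → c i ∈ bag D x × c j ∈ bag D x
    commonNode i j with i ≟ j
    ... | no i≢j = coverEdge D (clique i≢j)
    ... | yes refl = let x , ci∈x = covers D (c i) in x , ci∈x , ci∈x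

    asym : ∀ {t u} → Arrow t u → ¬ Arrow u t
    asym (t~u , i , p) (_ , j , q) =
      let x , ci∈x , cj∈x = commonNode i j in sides-disjoint t~u (p ci∈x) (q cj∈x)

    next : ∀ t → (∀ i → c i ∈ bag D t) ⊎ ∃ λ u → Adj (tree D) t u × Arrow t u
    next t with all? (λ i → c i ∈? bag D t)
    ... | yes all = inj₁ all
    ... | no ¬all =
      let i , ci∉t = ¬∀⟶∃¬ m _ (λ i → c i ∈? bag D t) ¬all
          x , ci∈x = covers D (c i)
          u , t~u , p = branch t λ x≡t → ci∉t (subst (λ y → c i ∈ bag D y) x≡t ci∈x)
      in inj₂ (u , t~u , t~u , i , λ ci∈y → bag-side ci∉t ci∈x ci∈y p)

-- Finite sums and counting with indicators.

ind : ∀ {a} {P : Set a} → Dec P → ℕ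
ind d = if does d then 1 else 0

module _ {a} {P : Set a} where

  ind≤1 : (d : Dec P) → ind d ≤ 1
  ind≤1 (yes _) = ≤-refl
  ind≤1 (no _)  = z≤n

  ind≡1 : (d : Dec P) → P → ind d ≡ 1
  ind≡1 (yes _) _ = refl
  ind≡1 (no ¬p) p = contradiction p ¬p

  ind≡0 : (d : Dec P) → ¬ P → ind d ≡ 0
  ind≡0 (yes p) ¬p = contradiction p ¬p
  ind≡0 (no _)  _  = refl

  ind>0⇒ : (d : Dec P) → 0 < ind d → P
  ind>0⇒ (yes p) _ = p

sum-mono-≤ : {f g : Fin n → ℕ} → (∀ i → f i ≤ g i) → sum f ≤ sum g
sum-mono-≤ {zero}  f≤g = z≤n
sum-mono-≤ {suc n} f≤g = +-mono-≤ (f≤g zero) (sum-mono-≤ (f≤g ∘ suc))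

sum-≤-* : ∀ {c} {f : Fin n → ℕ} → (∀ i → f i ≤ c) → sum f ≤ n * c
sum-≤-* {zero}  f≤c = z≤n
sum-≤-* {suc n} f≤c = +-mono-≤ (f≤c zero) (sum-≤-* (f≤c ∘ suc))

*-≤-sum : ∀ {c} {f : Fin n → ℕ} → (∀ i → c ≤ f i) → n * c ≤ sum f
*-≤-sum {zero}  c≤f = z≤n
*-≤-sum {suc n} c≤f = +-mono-≤ (c≤f zero) (*-≤-sum (c≤f ∘ suc))

term≤sum : (f : Fin n → ℕ) (i : Fin n) → f i ≤ sum f
term≤sum f zero    = m≤m+n _ _
term≤sum f (suc i) = ≤-trans (term≤sum (f ∘ suc) i) (m≤n+m _ (f zero))

sum>0⇒∃ : (f : Fin n → ℕ) → 0 < sum f → ∃ λ i → 0 < f i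
sum>0⇒∃ {suc n} f pos with f zero in eq
... | suc _ = zero , subst (0 <_) (sym eq) (s≤s z≤n)
... | zero  = let i , fi>0 = sum>0⇒∃ (f ∘ suc) pos in suc i , fi>0

sum-≤1 : {f : Fin n → ℕ} → (∀ i → f i ≤ 1) →
         (∀ {i j} → 0 < f i → 0 < f j → i ≡ j) → sum f ≤ 1
sum-≤1 {zero}  _ _ = z≤n
sum-≤1 {suc n} {f} f≤1 unique with f zero in eq
... | zero  = sum-≤1 (f≤1 ∘ suc) (λ p q → Fin.suc-injective (unique p q))
... | suc l = +-mono-≤ (subst (_≤ 1) eq (f≤1 zero)) (subst (sum (f ∘ suc) ≤_) (*-zeroʳ n) (sum-≤-* rest≤0))
  where
  rest≤0 : ∀ i → f (suc i) ≤ 0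
  rest≤0 i = ≮⇒≥ λ pos →
    Fin.0≢1+n (unique (subst (0 <_) (sym eq) (s≤s z≤n)) pos)

-- For indicators of membership in classes `u`, this counts the pairs lying in a common class, class
-- by class.
sum-*-sum : (f : Fin k → Fin m → ℕ) (g : Fin k → Fin n → ℕ) →
            (∑[ i < m ] ∑[ j < n ] ∑[ u < k ] (f u i * g u j)) ≡ (∑[ u < k ] (sum (f u) * sum (g u)))
sum-*-sum {k} {m} {n} f g = begin
  (∑[ i < m ] ∑[ j < n ] ∑[ u < k ] (f u i * g u j))
    ≡⟨ sum-cong-≗ (λ i → ∑-comm (λ j u → f u i * g u j)) ⟩
  (∑[ i < m ] ∑[ u < k ] ∑[ j < n ] (f u i * g u j))
    ≡⟨ ∑-comm (λ i u → ∑[ j < n ] (f u i * g u j)) ⟩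
  (∑[ u < k ] ∑[ i < m ] ∑[ j < n ] (f u i * g u j))
    ≡⟨ sum-cong-≗ (λ u → sum-cong-≗ (λ i → sym (*-distribˡ-sum (f u i) (g u)))) ⟩
  (∑[ u < k ] ∑[ i < m ] (f u i * sum (g u)))
    ≡⟨ sum-cong-≗ (λ u → sym (*-distribʳ-sum (sum (g u)) (f u))) ⟩
  (∑[ u < k ] (sum (f u) * sum (g u))) ∎
  where open ≡-Reasoning

sum-ind-∈ : (S : Subset n) → (∑[ i < n ] ind (i ∈? S)) ≡ ∣ S ∣
sum-ind-∈ []          = refl
sum-ind-∈ (true ∷ S)  = cong suc (sum-ind-∈ S)
sum-ind-∈ (false ∷ S) = sum-ind-∈ S

Injective₂ : (Fin k → Fin m → Fin n) → Set
Injective₂ e = ∀ {a b a′ b′} → e a b ≡ e a′ b′ → a ≡ a′ × b ≡ b′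

-- Double counting: each indicator is spread over the elements `i` that equal `e a b`, and after
-- exchanging the sums injectivity leaves at most one pair for each `i`.
image-∈-≤ : {e : Fin k → Fin m → Fin n} → Injective₂ e → (S : Subset n) →
            (∑[ a < k ] ∑[ b < m ] ind (e a b ∈? S)) ≤ ∣ S ∣
image-∈-≤ {k} {m} {n} {e} inj S = begin
  (∑[ a < k ] ∑[ b < m ] ind (e a b ∈? S))
    ≤⟨ sum-mono-≤ (λ a → sum-mono-≤ (λ b → spread a b)) ⟩
  (∑[ a < k ] ∑[ b < m ] ∑[ i < n ] (hit a b i * ind (i ∈? S)))
    ≡⟨ sum-cong-≗ (λ a → ∑-comm (λ b i → hit a b i * ind (i ∈? S))) ⟩
  (∑[ a < k ] ∑[ i < n ] ∑[ b < m ] (hit a b i * ind (i ∈? S)))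
    ≡⟨ ∑-comm (λ a i → ∑[ b < m ] (hit a b i * ind (i ∈? S))) ⟩
  (∑[ i < n ] ∑[ a < k ] ∑[ b < m ] (hit a b i * ind (i ∈? S)))
    ≡⟨ sum-cong-≗ (λ i → sum-cong-≗ (λ a →
         sym (*-distribʳ-sum (ind (i ∈? S)) (λ b → hit a b i)))) ⟩
  (∑[ i < n ] ∑[ a < k ] ((∑[ b < m ] hit a b i) * ind (i ∈? S)))
    ≡⟨ sum-cong-≗ (λ i → sym (*-distribʳ-sum (ind (i ∈? S)) (λ a → ∑[ b < m ] hit a b i))) ⟩
  (∑[ i < n ] ((∑[ a < k ] ∑[ b < m ] hit a b i) * ind (i ∈? S)))
    ≤⟨ sum-mono-≤ (λ i → *-monoˡ-≤ (ind (i ∈? S)) (hit-once i)) ⟩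
  (∑[ i < n ] (1 * ind (i ∈? S)))
    ≡⟨ sum-cong-≗ (λ i → *-identityˡ (ind (i ∈? S))) ⟩
  (∑[ i < n ] ind (i ∈? S))
    ≡⟨ sum-ind-∈ S ⟩
  ∣ S ∣ ∎
  where
  open ≤-Reasoning

  hit : Fin k → Fin m → Fin n → ℕ
  hit a b i = ind (e a b ≟ i)

  spread : ∀ a b → ind (e a b ∈? S) ≤ (∑[ i < n ] (hit a b i * ind (i ∈? S)))
  spread a b = begin
    ind (e a b ∈? S)                     ≡⟨ *-identityˡ _ ⟨
    1 * ind (e a b ∈? S)                 ≡⟨ cong (_* ind (e a b ∈? S)) (ind≡1 (e a b ≟ e a b) refl) ⟨
    hit a b (e a b) * ind (e a b ∈? S)   ≤⟨ term≤sum (λ i → hit a b i * ind (i ∈? S)) (e a b) ⟩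
    (∑[ i < n ] (hit a b i * ind (i ∈? S))) ∎

  hit-once : ∀ i → (∑[ a < k ] ∑[ b < m ] hit a b i) ≤ 1
  hit-once i = sum-≤1
    (λ a → sum-≤1 (λ b → ind≤1 (e a b ≟ i))
      (λ {b} {b′} p q → proj₂ (inj (trans (ind>0⇒ (e a b ≟ i) p) (sym (ind>0⇒ (e a b′ ≟ i) q))))))
    (λ {a} {a′} p q →
      let b , r = sum>0⇒∃ (λ b → hit a b i) p
          b′ , s = sum>0⇒∃ (λ b → hit a′ b i) q
      in proj₁ (inj (trans (ind>0⇒ (e a b ≟ i) r) (sym (ind>0⇒ (e a′ b′ ≟ i) s)))))

-- The inequality of arithmetic and geometric means.

4xy≤[x+y]² : ∀ x y → 4 * (x * y) ≤ (x + y) * (x + y)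
4xy≤[x+y]² x y with ≤-total x y
-- The two sides differ by the square of the gap `d` between the larger and the smaller number;
-- taking the larger first avoids subtraction.
... | inj₁ x≤y = let d , eq = m≤n⇒∃[o]m+o≡n x≤y in
  subst (λ y → 4 * (x * y) ≤ (x + y) * (x + y)) eq
    (≤-trans (m≤m+n _ (d * d)) (≤-reflexive (expand x d)))
  where
  expand : ∀ x d → 4 * (x * (x + d)) + d * d ≡ (x + (x + d)) * (x + (x + d))
  expand = solve-∀
... | inj₂ y≤x = let d , eq = m≤n⇒∃[o]m+o≡n y≤x in
  subst (λ x → 4 * (x * y) ≤ (x + y) * (x + y)) eq
    (≤-trans (m≤m+n _ (d * d)) (≤-reflexive (expand y d)))
  where
  expand : ∀ y d → 4 * ((y + d) * y) + d * d ≡ ((y + d) + y) * ((y + d) + y)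
  expand = solve-∀

-- AM-GM for qx and py, one factor of their sum being at most pq.
4xy≤qx+py : ∀ p q x y → 0 < p * q → q * x + p * y ≤ p * q → 4 * (x * y) ≤ q * x + p * y
4xy≤qx+py p q x y pq>0 bound = *-cancelˡ-≤ (p * q) {{ℕ.>-nonZero pq>0}} (begin
  p * q * (4 * (x * y))                     ≡⟨ regroup p q x y ⟩
  4 * (q * x * (p * y))                     ≤⟨ 4xy≤[x+y]² (q * x) (p * y) ⟩
  (q * x + p * y) * (q * x + p * y)         ≤⟨ *-monoˡ-≤ (q * x + p * y) bound ⟩
  p * q * (q * x + p * y)                   ∎)
  where
  open ≤-Reasoning
  regroup : ∀ p q x y → p * q * (4 * (x * y)) ≡ 4 * (q * x * (p * y))
  regroup = solve-∀

-- Branch loads and the weighted centroid.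

module Load {T : Graph n} (isTree : IsTree T) where
  open Tree isTree

  -- Adjacency is included so that sums can run over every node `u`, the nonadjacent ones
  -- contributing 0.
  Branch : Fin n → Fin n → Fin n → Set
  Branch t u x = Adj T t u × Side T t u x

  branch? : ∀ t u x → Dec (Branch t u x)
  branch? t u x with adj? T t u
  ... | no t≁u = no (t≁u ∘ proj₁)
  ... | yes t~u with side? t~u x
  ...   | yes p = yes (t~u , p)
  ...   | no ¬p = no (¬p ∘ proj₂)

  load : (Fin k → Fin n) → Fin n → Fin n → ℕ
  load {k} α t u = ∑[ i < k ] ind (branch? t u (α i))

  load-nonadj : (α : Fin k → Fin n) → ∀ {t u} → ¬ Adj T t u → load α t u ≡ 0
  load-nonadj {k} α {t} {u} t≁u = n≤0⇒n≡0 (subst (load α t u ≤_) (*-zeroʳ k)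
    (sum-≤-* (λ i → ≤-reflexive (ind≡0 (branch? t u (α i)) (t≁u ∘ proj₁)))))

  -- The two sides of an edge are disjoint, so each `α i` is counted at most once.
  load-opposite : (α : Fin k → Fin n) → ∀ t u → load α t u + load α u t ≤ k
  load-opposite {k} α t u = begin
    load α t u + load α u t
      ≡⟨ ∑-distrib-+ (λ i → ind (branch? t u (α i))) (λ i → ind (branch? u t (α i))) ⟨
    (∑[ i < k ] (ind (branch? t u (α i)) + ind (branch? u t (α i))))
      ≤⟨ sum-≤-* (λ i → one (α i)) ⟩
    k * 1
      ≡⟨ *-identityʳ k ⟩
    k ∎
    where
    open ≤-Reasoning
    one : ∀ x → ind (branch? t u x) + ind (branch? u t x) ≤ 1
    one x with branch? t u x | branch? u t x
    ... | yes (t~u , p) | yes (_ , q) = contradiction q (sides-disjoint t~u p)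
    ... | yes _         | no _        = ≤-refl
    ... | no _          | yes _       = ≤-refl
    ... | no _          | no _        = z≤n

  -- The branches at `t` are pairwise disjoint; an `α i` equal to `t` lies in none of them.
  load-total : (α : Fin k → Fin n) → ∀ t → (∑[ u < n ] load α t u) ≤ k
  load-total {k} α t = begin
    (∑[ u < n ] load α t u)
      ≡⟨ ∑-comm (λ u i → ind (branch? t u (α i))) ⟩
    (∑[ i < k ] ∑[ u < n ] ind (branch? t u (α i)))
      ≤⟨ sum-≤-* (λ i → sum-≤1 (λ u → ind≤1 (branch? t u (α i))) (λ {u} {v} → unique (α i) u v)) ⟩
    k * 1
      ≡⟨ *-identityʳ k ⟩
    k ∎
    where
    open ≤-Reasoning
    unique : ∀ x u v → 0 < ind (branch? t u x) → 0 < ind (branch? t v x) → u ≡ v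
    unique x u v p q =
      let t~u , r = ind>0⇒ (branch? t u x) p
          t~v , s = ind>0⇒ (branch? t v x) q
      in side-unique t~u t~v r s

  -- The total weight is `2 * (p * q)`, so an arrow points to a branch holding more than half of it.
  -- Opposite arrows would give two disjoint branches whose weights exceed the total.
  centroid : ∀ {p q} (α : Fin p → Fin n) (β : Fin q → Fin n) → Fin n →
             ∃ λ t → ∀ u → q * load α t u + p * load β t u ≤ p * q
  centroid {p} {q} α β = sink {Arrow} (λ {t} {u} → asym t u) next
    where
    weight : Fin n → Fin n → ℕ
    weight t u = q * load α t u + p * load β t u

    Arrow : Fin n → Fin n → Set
    Arrow t u = p * q < weight t u

    asym : ∀ t u → Arrow t u → ¬ Arrow u t
    asym t u heavy heavy′ = <-irrefl refl (begin-strict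
      p * q + p * q
        <⟨ +-mono-< heavy heavy′ ⟩
      weight t u + weight u t
        ≡⟨ regroup p q (load α t u) (load β t u) (load α u t) (load β u t) ⟩
      q * (load α t u + load α u t) + p * (load β t u + load β u t)
        ≤⟨ +-mono-≤ (*-monoʳ-≤ q (load-opposite α t u)) (*-monoʳ-≤ p (load-opposite β t u)) ⟩
      q * p + p * q
        ≡⟨ cong (_+ p * q) (*-comm q p) ⟩
      p * q + p * q ∎)
      where
      open ≤-Reasoning
      regroup : ∀ p q x y x′ y′ →
                (q * x + p * y) + (q * x′ + p * y′) ≡ q * (x + x′) + p * (y + y′)
      regroup = solve-∀

    heavy⇒adj : ∀ {t u} → Arrow t u → Adj T t u
    heavy⇒adj {t} {u} heavy = decidable-stable (adj? T t u) λ t≁u →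
      n≮0 (subst (p * q <_) (weight≡0 t≁u) heavy)
      where
      weight≡0 : ¬ Adj T t u → weight t u ≡ 0
      weight≡0 t≁u = trans
        (cong₂ (λ x y → q * x + p * y) (load-nonadj α t≁u) (load-nonadj β t≁u))
        (cong₂ _+_ (*-zeroʳ q) (*-zeroʳ p))

    next : ∀ t → _
    next t with any? (λ u → p * q <? weight t u)
    ... | yes (u , heavy) = inj₂ (u , heavy⇒adj heavy , heavy)
    ... | no none         = inj₁ λ u → ≮⇒≥ λ heavy → none (u , heavy)

-- A large bag from a grid of row and column cliques.

module _ {H : Graph n} (D : TreeDecomposition H) where
  open Decomposition D
  open Load (isTree D)

  centroidBag : ∀ {p q} → 0 < p * q → {e : Fin p → Fin q → Fin n} → Injective₂ e →
                (α : Fin p → Fin (size D)) → (∀ a b → e a b ∈ bag D (α a)) →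
                (β : Fin q → Fin (size D)) → (∀ a b → e a b ∈ bag D (β b)) →
                ∀ t → (∀ u → q * load α t u + p * load β t u ≤ p * q) →
                p * q ≤ 2 * ∣ bag D t ∣
  centroidBag {p} {q} pq>0 {e} inj α rows β cols t light =
    *-cancelˡ-≤ 2 (+-cancelʳ-≤ (2 * (p * q)) _ _ (begin
      -- Scaling by 4 clears the fractions of the count: at most `p * q` halves of pairs are
      -- missing, which becomes `2 * (p * q)`, cancelled before the factor 2.
      2 * (p * q) + 2 * (p * q)
        ≡⟨ double p q ⟩
      4 * (p * q)
        ≤⟨ *-monoʳ-≤ 4 pairs ⟩
      4 * (∣ bag D t ∣ + (∑[ u < size D ] (load α t u * load β t u)))
        ≡⟨ *-distribˡ-+ 4 ∣ bag D t ∣ _ ⟩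
      4 * ∣ bag D t ∣ + 4 * (∑[ u < size D ] (load α t u * load β t u))
        ≤⟨ +-monoʳ-≤ (4 * ∣ bag D t ∣) sameBranch ⟩
      4 * ∣ bag D t ∣ + 2 * (p * q)
        ≡⟨ cong (_+ 2 * (p * q)) (*-assoc 2 2 ∣ bag D t ∣) ⟩
      2 * (2 * ∣ bag D t ∣) + 2 * (p * q) ∎))
    where
    open ≤-Reasoning

    double : ∀ p q → 2 * (p * q) + 2 * (p * q) ≡ 4 * (p * q)
    double = solve-∀

    -- If `e a b` is missing at `t`, its bags lie in a single branch, and both `α a` and `β b` carry
    -- such bags.
    pair : ∀ a b → 1 ≤ ind (e a b ∈? bag D t) +
                   (∑[ u < size D ] (ind (branch? t u (α a)) * ind (branch? t u (β b))))
    pair a b with e a b ∈? bag D t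
    ... | yes _  = s≤s z≤n
    ... | no e∉t =
      let u , t~u , r = branch t λ α≡t → e∉t (subst (λ x → e a b ∈ bag D x) α≡t (rows a b))
          s = bag-side e∉t (rows a b) (cols a b) r
      in ≤-trans
           (≤-reflexive (sym (cong₂ _*_ (ind≡1 (branch? t u (α a)) (t~u , r))
                                        (ind≡1 (branch? t u (β b)) (t~u , s)))))
           (term≤sum (λ u → ind (branch? t u (α a)) * ind (branch? t u (β b))) u)

    pairs : p * q ≤ ∣ bag D t ∣ + (∑[ u < size D ] (load α t u * load β t u))
    pairs = begin
      p * q
        ≡⟨ cong (p *_) (*-identityʳ q) ⟨
      p * (q * 1)
        ≤⟨ *-≤-sum (λ a → *-≤-sum (λ b → pair a b)) ⟩
      (∑[ a < p ] ∑[ b < q ] (inBag a b + same a b))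
        ≡⟨ sum-cong-≗ (λ a → ∑-distrib-+ (inBag a) (same a)) ⟩
      (∑[ a < p ] (sum (inBag a) + sum (same a)))
        ≡⟨ ∑-distrib-+ (λ a → sum (inBag a)) (λ a → sum (same a)) ⟩
      (∑[ a < p ] sum (inBag a)) + (∑[ a < p ] sum (same a))
        ≤⟨ +-mono-≤ (image-∈-≤ inj (bag D t)) (≤-reflexive
             (sum-*-sum (λ u a → ind (branch? t u (α a))) (λ u b → ind (branch? t u (β b))))) ⟩
      ∣ bag D t ∣ + (∑[ u < size D ] (load α t u * load β t u)) ∎
      where
      inBag same : Fin p → Fin q → ℕ
      inBag a b = ind (e a b ∈? bag D t)
      same a b = ∑[ u < size D ] (ind (branch? t u (α a)) * ind (branch? t u (β b)))

    -- The bound for one branch is its own weight, so summing over the branches gives at most the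
    -- total weight.
    sameBranch : 4 * (∑[ u < size D ] (load α t u * load β t u)) ≤ 2 * (p * q)
    sameBranch = begin
      4 * (∑[ u < size D ] (load α t u * load β t u))
        ≡⟨ *-distribˡ-sum 4 (λ u → load α t u * load β t u) ⟩
      (∑[ u < size D ] (4 * (load α t u * load β t u)))
        ≤⟨ sum-mono-≤ (λ u → 4xy≤qx+py p q (load α t u) (load β t u) pq>0 (light u)) ⟩
      (∑[ u < size D ] (q * load α t u + p * load β t u))
        ≡⟨ ∑-distrib-+ (λ u → q * load α t u) (λ u → p * load β t u) ⟩
      (∑[ u < size D ] (q * load α t u)) + (∑[ u < size D ] (p * load β t u))
        ≡⟨ cong₂ _+_ (*-distribˡ-sum q (load α t)) (*-distribˡ-sum p (load β t)) ⟨
      q * (∑[ u < size D ] load α t u) + p * (∑[ u < size D ] load β t u)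
        ≤⟨ +-mono-≤ (*-monoʳ-≤ q (load-total α t)) (*-monoʳ-≤ p (load-total β t)) ⟩
      q * p + p * q
        ≡⟨ swap p q ⟩
      2 * (p * q) ∎
      where
      swap : ∀ p q → q * p + p * q ≡ 2 * (p * q)
      swap = solve-∀

  -- Every row and every column is a clique; the nodes whose bags contain them serve as `α` and `β`.
  gridBag : ∀ {p q} → 0 < p * q → {e : Fin p → Fin q → Fin n} → Injective₂ e →
            (∀ {a b b′} → b ≢ b′ → Adj H (e a b) (e a b′)) →
            (∀ {a a′ b} → a ≢ a′ → Adj H (e a b) (e a′ b)) →
            ∃ λ t → p * q ≤ 2 * ∣ bag D t ∣
  gridBag {p} {q} pq>0 {e} inj rows cols =
    let row a = cliqueBag (e a) rows
        col b = cliqueBag (λ a → e a b) cols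
        α = proj₁ ∘ row
        β = proj₁ ∘ col
        t , light = centroid α β someNode
    in t , centroidBag pq>0 inj α (λ a b → proj₂ (row a) b) β (λ a b → proj₂ (col b) a) t light

  bag≤maxBag : ∀ t → ∣ bag D t ∣ ≤ maxBag D
  bag≤maxBag t = v≤max⁺ 0 _ (inj₂ (Any.map ≤-reflexive (∈-tabulate⁺ t)))

-- The edges of the complete bipartite graph as a grid in its line graph.

module _ (p q : ℕ) where

  -- Left vertices precede right ones in `Fin (p + q)`, so the pair is in the orientation that
  -- `edges` lists.
  edge∈ : ∀ a b → (a ↑ˡ q , p ↑ʳ b) ∈ᴸ edges (K p q)
  edge∈ a b = ∈-filter⁺ (λ (u , v) → (u Fin.<? v) ×-dec adj? (K p q) u v)
    (∈-cartesianProduct⁺ (∈-allFin (a ↑ˡ q)) (∈-allFin (p ↑ʳ b)))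
    (lt , opposite)
    where
    open ≤-Reasoning
    lt : toℕ (a ↑ˡ q) < toℕ (p ↑ʳ b)
    lt = begin-strict
      toℕ (a ↑ˡ q) ≡⟨ Fin.toℕ-↑ˡ a q ⟩
      toℕ a        <⟨ Fin.toℕ<n a ⟩
      p            ≤⟨ m≤m+n p (toℕ b) ⟩
      p + toℕ b    ≡⟨ Fin.toℕ-↑ʳ p b ⟨
      toℕ (p ↑ʳ b) ∎
    opposite : Adj (K p q) (a ↑ˡ q) (p ↑ʳ b)
    opposite rewrite Fin.splitAt-↑ˡ p a q | Fin.splitAt-↑ʳ p q b = tt

  edge : Fin p → Fin q → Fin (length (edges (K p q)))
  edge a b = Any.index (edge∈ a b)

  lookup-edge : ∀ a b → (a ↑ˡ q , p ↑ʳ b) ≡ List.lookup (edges (K p q)) (edge a b)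
  lookup-edge a b = lookup-index (edge∈ a b)

  -- Equal positions look up the same pair of ends, and both embeddings of the parts are injective.
  edge-injective : Injective₂ edge
  edge-injective {a} {b} {a′} {b′} eq =
    Fin.↑ˡ-injective q a a′ (cong proj₁ ends) , Fin.↑ʳ-injective p b b′ (cong proj₂ ends)
    where
    ends : (a ↑ˡ q , p ↑ʳ b) ≡ (a′ ↑ˡ q , p ↑ʳ b′)
    ends = trans (lookup-edge a b)
      (trans (cong (List.lookup (edges (K p q))) eq) (sym (lookup-edge a′ b′)))

  edge-row : ∀ {a b b′} → b ≢ b′ → Adj (L (K p q)) (edge a b) (edge a b′)
  edge-row {a} {b} {b′} b≢b′ =
    (λ eq → b≢b′ (proj₂ (edge-injective eq))) ,
    subst₂ ShareEndpoint (lookup-edge a b) (lookup-edge a b′) (a ↑ˡ q , inj₁ refl , inj₁ refl)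

  edge-col : ∀ {a a′ b} → a ≢ a′ → Adj (L (K p q)) (edge a b) (edge a′ b)
  edge-col {a} {a′} {b} a≢a′ =
    (λ eq → a≢a′ (proj₁ (edge-injective eq))) ,
    subst₂ ShareEndpoint (lookup-edge a b) (lookup-edge a′ b) (p ↑ʳ b , inj₂ refl , inj₂ refl)

-- Passage to the rationals and conclusion.

half-≤ : ∀ N M → N ≤ 2 * M → ½ ℚ.* (+ N / 1) ℚ.- 1ℚ ℚ.≤ (+ M ℤ.- + 1) / 1
half-≤ N M N≤2M = ℚ.toℚᵘ-cancel-≤ (begin
  toℚᵘ (½ ℚ.* (+ N / 1) ℚ.- 1ℚ)
    ≃⟨ ℚ.toℚᵘ-homo-+ (½ ℚ.* (+ N / 1)) (ℚ.- 1ℚ) ⟩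
  toℚᵘ (½ ℚ.* (+ N / 1)) ℚᵘ.- ℚᵘ.1ℚᵘ
    ≃⟨ ℚᵘ.+-congˡ (ℚᵘ.- ℚᵘ.1ℚᵘ) (ℚ.toℚᵘ-homo-* ½ (+ N / 1)) ⟩
  ℚᵘ.½ ℚᵘ.* toℚᵘ (+ N / 1) ℚᵘ.- ℚᵘ.1ℚᵘ
    ≃⟨ ℚᵘ.+-congˡ (ℚᵘ.- ℚᵘ.1ℚᵘ) (ℚᵘ.*-congˡ {ℚᵘ.½} (ℚ.toℚᵘ-fromℚᵘ (mkℚᵘ (+ N) 0))) ⟩
  ℚᵘ.½ ℚᵘ.* mkℚᵘ (+ N) 0 ℚᵘ.- ℚᵘ.1ℚᵘ
    ≤⟨ *≤* core ⟩
  mkℚᵘ (+ M ℤ.- + 1) 0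
    ≃⟨ ℚ.toℚᵘ-fromℚᵘ (mkℚᵘ (+ M ℤ.- + 1) 0) ⟨
  toℚᵘ ((+ M ℤ.- + 1) / 1) ∎)
  where
  open ℚᵘ.≤-Reasoning
  numerator-lhs : ∀ i → ((+ 1 ℤ.* i) ℤ.* + 1 ℤ.+ ℤ.- (+ 1) ℤ.* + 2) ℤ.* + 1 ≡ i ℤ.+ ℤ.- (+ 2)
  numerator-lhs = ℤSolver.solve-∀
  numerator-rhs : ∀ i → (i ℤ.- + 1) ℤ.* + 2 ≡ + 2 ℤ.* i ℤ.+ ℤ.- (+ 2)
  numerator-rhs = ℤSolver.solve-∀
  -- Cross-multiplied, with denominator 2 on the left and 1 on the right, the inequality reads
  -- `N - 2 ≤ 2 * M - 2`.
  core : ((+ 1 ℤ.* + N) ℤ.* + 1 ℤ.+ ℤ.- (+ 1) ℤ.* + 2) ℤ.* + 1 ℤ.≤ (+ M ℤ.- + 1) ℤ.* + 2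
  core = subst₂ ℤ._≤_ (sym (numerator-lhs (+ N))) (sym (numerator-rhs (+ M)))
    (ℤ.+-monoˡ-≤ (ℤ.- (+ 2)) (subst (+ N ℤ.≤_) (ℤ.pos-* 2 M) (ℤ.+≤+ N≤2M)))

theorem1p4 : (p q : ℕ) → p ℕ.≥ q → q ℕ.≥ 1 →
    (tw pw : ℤ) → IsTreewidth (L (K p q)) tw → IsPathwidth (L (K p q)) pw →
    (½ ℚ.* (+ (p ℕ.* q) / 1) ℚ.- 1ℚ ℚ.≤ tw / 1) × (tw ℤ.≤ pw)
theorem1p4 p q p≥q q≥1 _ _ ((D , refl) , tw≤) (((P , _) , refl) , _) =
  -- `D` attains the treewidth, so `tw` is `maxBag D` minus 1, and the largest bag is at least as
  -- big as the one found at `t`.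
  (let t , pq≤2t = gridBag D (*-mono-≤ (≤-trans q≥1 p≥q) q≥1)
                     (edge-injective p q) (edge-row p q) (edge-col p q)
   in half-≤ (p * q) (maxBag D) (≤-trans pq≤2t (*-monoʳ-≤ 2 (bag≤maxBag D t)))) ,
  -- The optimal path decomposition is one of the tree decompositions over which `tw` is minimal.
  tw≤ P
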